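{- For every even integer $k \geq 6$ and every odd integer $y \geq 1$, the graph $K_3 \times K_{ky}$ has a $C_k$-factorization.
   Context: $K_n$ is the complete graph on $n$ vertices. For graphs $G,H$, the tensor product $G \times H$ has vertex set $V(G)\times V(H)$, with $(g_1,h_1)$ adjacent to $(g_2,h_2)$ iff $g_1g_2 \in E(G)$ and $h_1h_2 \in E(H)$. A $C_k$-factor of a graph is a spanning subgraph all of whose components are cycles of length $k$; a $C_k$-factorization is a partition of the edge set into $C_k$-factors. -}

module Defs where

open import Level using (0ℓ)
open import Data.Nat using (ℕ; zero; suc; _*_; NonZero)
open import Data.Nat.DivMod using (_%_; m%n<n)
open import Data.Fin using (Fin; toℕ; fromℕ<)
open import Data.Product using (Σ; _×_; _,_; ∃)
open import Data.Sum using (_⊎_)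
open import Relation.Binary.PropositionalEquality using (_≡_; _≢_)
open import Function.Definitions using (Injective)

-- A simple graph: vertex type with an adjacency relation
-- (all graphs below have irreflexive, symmetric adjacency).
record Graph : Set₁ where
  field
    V   : Set
    Adj : V → V → Set
open Graph public

K : ℕ → Graph
K n = record { V = Fin n ; Adj = λ a b → a ≢ b }

_⊗_ : Graph → Graph → Graph
G ⊗ H = record
  { V   = V G × V H
  ; Adj = λ { (g₁ , h₁) (g₂ , h₂) → Adj G g₁ g₂ × Adj H h₁ h₂ } }

next : ∀ {k} → Fin k → Fin k
next {suc n} i = fromℕ< (m%n<n (suc (toℕ i)) (suc n))

record Cycle (k : ℕ) (G : Graph) : Set where
  field
    walk     : Fin k → V G
    distinct : Injective _≡_ _≡_ walk
    closed   : ∀ i → Adj G (walk i) (walk (next i))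
open Cycle public

OnCycle : ∀ {k G} → Cycle k G → V G → Set
OnCycle C v = ∃ λ i → walk C i ≡ v

CycleEdge : ∀ {k G} → Cycle k G → V G → V G → Set
CycleEdge C u v = ∃ λ i →
  (walk C i ≡ u × walk C (next i) ≡ v) ⊎ (walk C i ≡ v × walk C (next i) ≡ u)

∃! : {A : Set} → (A → Set) → Set
∃! {A} P = Σ A λ x → P x × (∀ y → P y → y ≡ x)

record CkFactor (k : ℕ) (G : Graph) : Set where
  field
    size   : ℕ
    cycles : Fin size → Cycle k G
    covers : ∀ v → ∃! λ j → OnCycle (cycles j) v
open CkFactor public

-- A C_k-factorization of G: a finite family of C_k-factors whose edge sets
-- partition E(G): every edge of G lies on exactly one cycle of exactly one
-- factor (cycle edges are automatically edges of G).
record CkFactorization (k : ℕ) (G : Graph) : Set where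
  field
    count   : ℕ
    factors : Fin count → CkFactor k G
    partition : ∀ u v → Adj G u v →
      ∃! {Σ (Fin count) λ f → Fin (size (factors f))}
         (λ { (f , j) → CycleEdge (cycles (factors f) j) u v })
open CkFactorization public

{-# OPTIONS --safe #-}
module Submission where

-- Write k = 2h and split the ky points of K_{ky} into 2y layers of size h.  Take a
-- 1-factorization of K_{2y} on the layers.  A pair of layers matched by the first
-- 1-factor carries a C_k-factorization of K_3 × K_{2h}, a pair matched by any other
-- one a C_k-factorization of K_3 × K_{h,h}; this gives (2h - 1) + (2y - 2) h = ky - 1
-- factors, the right number.
--
-- Both ingredients are invariant under rotating K_3 and cyclic on the points: a factor
-- is a Hamiltonian cycle in which every difference occurs twice, together with levels
-- in Z_3 such that the two occurrences of a difference climb in opposite directions.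
-- For K_{h,h} the cycle is the zigzag 0, 0', 1, -1', 2, -2', ... over Z_h.  For K_{2h}
-- on Z_{2h-1} ∪ {∞} it is A_0, ..., A_{h-1}, A_{h-1} + h - 1, ..., A_1 + h - 1, ∞,
-- where A is the graceful path 0, h - 1, 1, h - 2, ...; the second half traverses all
-- differences but h - 1 in the direction opposite to the first half.

open import Defs
open import Data.Fin as Fin using (Fin; zero; suc; toℕ; fromℕ<; punchIn; punchOut; combine; remQuot)
import Data.Fin.Properties as Fin
open import Data.Integer as ℤ using (ℤ; +_; -[1+_]; _+_; _-_; -_; _/ℕ_)
open import Data.Integer.DivMod using (n%ℕd<d; a≡a%ℕn+[a/ℕn]*n)
import Data.Integer.Properties as ℤ
open import Data.Integer.Tactic.RingSolver using (solve-∀)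
open import Data.Nat as ℕ using (ℕ; zero; suc; _*_; _∸_; _≤_; _<_; z≤n; s≤s)
open import Data.Nat.DivMod using (m<n⇒m%n≡m; n%n≡0; [m+kn]%n≡m%n)
open import Data.Nat.Divisibility using (_∣_; divides)
import Data.Nat.Properties as ℕ
open import Data.Nat.Tactic.RingSolver using () renaming (solve-∀ to ℕ-solve-∀)
open import Data.Product as Σ using (Σ; ∃; ∃₂; _×_; _,_; proj₁; proj₂)
open import Data.Product.Function.NonDependent.Propositional using (_×-↔_)
open import Data.Sum as ⊎ using (_⊎_; inj₁; inj₂; swap)
open import Data.Sum.Function.Propositional using (_⊎-↔_)
open import Data.Unit using (⊤; tt)
open import Function using (_∘_; id; _↔_; Inverse; Injection)
open import Function.Definitions using (Injective)
open import Function.Properties.Inverse using (↔-refl; ↔-sym; ↔-trans; ↔⇒↣)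
open import Relation.Binary using (tri<; tri≈; tri>)
open import Relation.Binary.PropositionalEquality
open import Relation.Nullary using (¬_; yes; no; contradiction; ¬?; _→-dec_; _⊎-dec_)
open import Relation.Nullary.Decidable using (from-yes)

-- Counting, levels and rotation-invariant families of closed walks

-- Pigeonhole: were `y` missed, punching it out of the codomain would inject `Fin (suc n)` into
-- `Fin n`.
Fin-injective⇒onto : ∀ {n} (f : Fin n → Fin n) → Injective _≡_ _≡_ f → ∀ y → ∃ λ x → f x ≡ y
Fin-injective⇒onto {suc n} f f-inj y with Fin.any? (λ x → f x Fin.≟ y)
... | yes hit = hit
... | no miss = contradiction
  (Fin.injective⇒≤ λ {a} {b} eq → f-inj (Fin.punchOut-injective (avoid a) (avoid b) eq))
  ℕ.1+n≰n
  where
  avoid : ∀ x → y ≢ f x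
  avoid x y≡fx = miss (x , sym y≡fx)

↔-injective : ∀ {A B : Set} (A↔B : A ↔ B) → Injective _≡_ _≡_ (Inverse.to A↔B)
↔-injective A↔B = Injection.injective (↔⇒↣ A↔B)

injective⇒onto : ∀ {A B : Set} {m n} → Fin m ↔ A → Fin n ↔ B → m ≡ n →
  (f : A → B) → Injective _≡_ _≡_ f → ∀ b → ∃ λ a → f a ≡ b
injective⇒onto A↔ B↔ refl f f-inj b
  with x , eq ← Fin-injective⇒onto
                  (Inverse.from B↔ ∘ f ∘ Inverse.to A↔)
                  (↔-injective A↔ ∘ f-inj ∘ ↔-injective (↔-sym B↔))
                  (Inverse.from B↔ b)
  = Inverse.to A↔ x , ↔-injective (↔-sym B↔) eq

rot : Fin 3 → Fin 3
rot zero             = suc zero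
rot (suc zero)       = suc (suc zero)
rot (suc (suc zero)) = zero

rot-≢ : ∀ u → u ≢ rot u
rot-≢ = from-yes (Fin.all? λ u → ¬? (u Fin.≟ rot u))

-- A climb is never also a descent, so only one orientation of an edge climbs.
rot²-≢ : ∀ u → u ≢ rot (rot u)
rot²-≢ = from-yes (Fin.all? λ u → ¬? (u Fin.≟ rot (rot u)))

rot-total : ∀ u v → u ≢ v → v ≡ rot u ⊎ u ≡ rot v
rot-total = from-yes (Fin.all? λ u → Fin.all? λ v →
  ¬? (u Fin.≟ v) →-dec (v Fin.≟ rot u ⊎-dec u Fin.≟ rot v))

infixl 6 _⊕_
_⊕_ : Fin 3 → Fin 3 → Fin 3
zero           ⊕ u = u
suc zero       ⊕ u = rot u
suc (suc zero) ⊕ u = rot (rot u)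

⊕-rot : ∀ c u → c ⊕ rot u ≡ rot (c ⊕ u)
⊕-rot zero             u = refl
⊕-rot (suc zero)       u = refl
⊕-rot (suc (suc zero)) u = refl

⊕-solve : ∀ u v → ∃ λ c → c ⊕ u ≡ v
⊕-solve = from-yes (Fin.all? λ u → Fin.all? λ v → Fin.any? λ c → c ⊕ u Fin.≟ v)

record Step {X : Set} (k : ℕ) (w : ℕ → X) (x y : X) : Set where
  constructor step
  field
    position : Fin k
    start    : w (toℕ position) ≡ x
    end      : w (toℕ (next position)) ≡ y

Link : ∀ {X : Set} → ℕ → (ℕ → X) → X → X → Set
Link k w x y = Step k w x y ⊎ Step k w y x

step-inner : ∀ {X : Set} {k} (w : ℕ → X) {i} → suc i < k → Step k w (w i) (w (suc i))
step-inner {k = suc k} w {i} 1+i<k = step (fromℕ< i<k) (cong w (Fin.toℕ-fromℕ< i<k)) (cong w (begin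
  toℕ (next (fromℕ< i<k))                ≡⟨ Fin.toℕ-fromℕ< _ ⟩
  suc (toℕ (fromℕ< i<k)) ℕ.% suc k       ≡⟨ cong (λ j → suc j ℕ.% suc k) (Fin.toℕ-fromℕ< i<k) ⟩
  suc i ℕ.% suc k                        ≡⟨ m<n⇒m%n≡m 1+i<k ⟩
  suc i                                  ∎))
  where
  open ≡-Reasoning
  i<k = ℕ.<-trans (ℕ.n<1+n i) 1+i<k

step-last : ∀ {X : Set} {k} (w : ℕ → X) {i} → suc i ≡ k → Step k w (w i) (w 0)
step-last w {i} refl = step (fromℕ< i<k) (cong w (Fin.toℕ-fromℕ< i<k)) (cong w (begin
  toℕ (next (fromℕ< i<k))                ≡⟨ Fin.toℕ-fromℕ< _ ⟩
  suc (toℕ (fromℕ< i<k)) ℕ.% suc i       ≡⟨ cong (λ j → suc j ℕ.% suc i) (Fin.toℕ-fromℕ< i<k) ⟩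
  suc i ℕ.% suc i                        ≡⟨ n%n≡0 (suc i) ⟩
  0                                      ∎))
  where
  open ≡-Reasoning
  i<k = ℕ.n<1+n i

step-cong : ∀ {X : Set} {k} {w w′ : ℕ → X} {x y} → (∀ i → w i ≡ w′ i) → Step k w x y → Step k w′ x y
step-cong w≗ (step i p q) = step i (trans (sym (w≗ _)) p) (trans (sym (w≗ _)) q)

step-map : ∀ {X Y : Set} {k} {w : ℕ → X} (f : X → Y) {x y} → Step k w x y → Step k (f ∘ w) (f x) (f y)
step-map f (step i p q) = step i (cong f p) (cong f q)

link-map : ∀ {X Y : Set} {k} {w : ℕ → X} (f : X → Y) {x y} → Link k w x y → Link k (f ∘ w) (f x) (f y)
link-map f = ⊎.map (step-map f) (step-map f)

Levelled : Set → Set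
Levelled W = Fin 3 × W

-- One level `c` is enough: the rotated copies of the walk carry the same arc from every other
-- level. The walk may run along the arc in either direction.
Joined : ∀ {Φ W : Set} → ℕ → (Φ → ℕ → Levelled W) → W → W → Set
Joined k walks a b = ∃₂ λ φ c → Link k (walks φ) (c , a) (rot c , b)

-- The cycles of factor φ are the closed walks walks φ j (positions 0, ..., k - 1)
-- and their images under rotation of the levels.
record Family (k : ℕ) (Φ J W : Set) (_∼_ : W → W → Set) : Set where
  field
    walks : Φ → J → ℕ → Levelled W
    onto  : ∀ φ a → ∃₂ λ j (i : Fin k) → proj₂ (walks φ j (toℕ i)) ≡ a
    arcs  : ∀ {a b} → a ∼ b → Joined k (Σ.uncurry walks) a b

-- Rotating the levels of every walk yields three times as many cycles.  There
-- are exactly as many positions on these cycles as there are vertices (in one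
-- factor) and edges (in all factors), so `onto` and `arcs` force uniqueness.
module _ {k y n} (F : Family k (Fin n) (Fin y) (Fin (suc n)) _≢_) (size≡ : suc n ≡ k * y) where
  open Family F

  private
    G : Graph
    G = K 3 ⊗ K (suc n)

    Place Slot Arc : Set
    Place = Fin (y * 3) × Fin k
    Slot  = Fin n × Place
    Arc   = Fin 3 × Fin (suc n) × Fin n

    lift : Fin 3 → V G → V G
    lift c = Σ.map₁ (c ⊕_)

    cycle : Fin n → Fin (y * 3) → ℕ → V G
    cycle φ j = let j′ , c = remQuot {y} 3 j in lift c ∘ walks φ j′

    cycle-combine : ∀ φ j c i → cycle φ (combine j c) i ≡ lift c (walks φ j i)
    cycle-combine φ j c i =
      cong (λ p → lift (proj₂ p) (walks φ (proj₁ p) i)) (Fin.remQuot-combine {y} {3} j c)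

    step-lift : ∀ {φ j c u v} → Step k (walks φ j) u v →
      Step k (cycle φ (combine j c)) (lift c u) (lift c v)
    step-lift {φ} {j} {c} (step i refl refl) = step i (cycle-combine φ j c _) (cycle-combine φ j c _)

    places≡vertices : 3 * suc n ≡ (y * 3) * k
    places≡vertices = trans (cong (3 *_) size≡) (rearrange k y)
      where
      rearrange : ∀ k y → 3 * (k * y) ≡ (y * 3) * k
      rearrange = ℕ-solve-∀

    arcs≡slots : 3 * (suc n * n) ≡ n * ((y * 3) * k)
    arcs≡slots = trans (cong (λ m → 3 * (m * n)) size≡) (rearrange k y n)
      where
      rearrange : ∀ k y n → 3 * ((k * y) * n) ≡ n * ((y * 3) * k)
      rearrange = ℕ-solve-∀

    place : ∀ φ v → Σ Place λ (j , i) → cycle φ j (toℕ i) ≡ v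
    place φ (t , a) with j , i , eq ← onto φ a
                    with c , c⊕≡t ← ⊕-solve (proj₁ (walks φ j (toℕ i))) t
      = (combine j c , i) , trans (cycle-combine φ j c (toℕ i)) (cong₂ _,_ c⊕≡t eq)

    -- A position determines the vertex standing on it, so `place φ` is injective; positions and
    -- vertices are equally many, hence no position is left over.
    placed : ∀ φ s → ∃ λ v → proj₁ (place φ v) ≡ s
    placed φ = injective⇒onto Fin.*↔× Fin.*↔× places≡vertices (proj₁ ∘ place φ) λ {u} {v} eq →
      trans (sym (proj₂ (place φ u)))
        (trans (cong (λ (j , i) → cycle φ j (toℕ i)) eq) (proj₂ (place φ v)))

    place-unique : ∀ φ {v j i} → cycle φ j (toℕ i) ≡ v → (j , i) ≡ proj₁ (place φ v)
    place-unique φ {j = j} {i} refl with v , refl ← placed φ (j , i) =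
      cong (proj₁ ∘ place φ) (sym (proj₂ (place φ v)))

    Joins : Slot → V G → V G → Set
    Joins (φ , j , i) u v = let w = cycle φ j in
      (w (toℕ i) ≡ u × w (toℕ (next i)) ≡ v) ⊎ (w (toℕ i) ≡ v × w (toℕ (next i)) ≡ u)

    -- Each edge appears here once, oriented so that its level climbs; `punchIn a` runs through the
    -- points other than `a`.
    tail head : Arc → V G
    tail (c , a , _) = c , a
    head (c , a , b) = rot c , punchIn a b

    slot : ∀ e → Σ Slot λ s → Joins s (tail e) (head e)
    slot (t , a , b) with arcs (Fin.punchInᵢ≢i a b ∘ sym)
    -- The family offers the arc from level `c`; the copy rotated by `d` offers it from level `t`.
    ... | (φ , j) , c , link with d , refl ← ⊕-solve c t rewrite sym (⊕-rot d c) with link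
    ...   | inj₁ st = let step i p q = step-lift st in (φ , combine j d , i) , inj₁ (p , q)
    ...   | inj₂ st = let step i p q = step-lift st in (φ , combine j d , i) , inj₂ (p , q)

    ends-injective : ∀ {e e′} → tail e ≡ tail e′ → head e ≡ head e′ → e ≡ e′
    ends-injective {_ , a , b} {_ , _ , b′} refl eq =
      cong (λ b → _ , a , b) (Fin.punchIn-injective a b b′ (cong proj₂ eq))

    -- The slot fixes the two ends. If it were read in opposite directions by two arcs, both
    -- readings would climb, and a level would equal its double rotation.
    joins-functional : ∀ s {e e′} → Joins s (tail e) (head e) → Joins s (tail e′) (head e′) → e ≡ e′
    joins-functional s (inj₁ (p , q)) (inj₁ (p′ , q′)) = ends-injective (trans (sym p) p′) (trans (sym q) q′)
    joins-functional s (inj₂ (p , q)) (inj₂ (p′ , q′)) = ends-injective (trans (sym q) q′) (trans (sym p) p′)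
    joins-functional s {e} (inj₁ (p , q)) (inj₂ (p′ , q′)) = contradiction
      (trans (cong proj₁ (trans (sym p) p′)) (cong rot (cong proj₁ (trans (sym q′) q)))) (rot²-≢ (proj₁ e))
    joins-functional s {e} (inj₂ (p , q)) (inj₁ (p′ , q′)) = contradiction
      (trans (cong proj₁ (trans (sym q) q′)) (cong rot (cong proj₁ (trans (sym p′) p)))) (rot²-≢ (proj₁ e))

    -- Distinct arcs get distinct slots by `joins-functional`, and arcs and slots are equally many.
    slotted : ∀ s → ∃ λ e → proj₁ (slot e) ≡ s
    slotted = injective⇒onto
      (↔-trans Fin.*↔× (↔-refl ×-↔ Fin.*↔×)) (↔-trans Fin.*↔× (↔-refl ×-↔ Fin.*↔×))
      arcs≡slots (proj₁ ∘ slot) λ {e} {e′} eq →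
      joins-functional (proj₁ (slot e′))
        (subst (λ s → Joins s (tail e) (head e)) eq (proj₂ (slot e))) (proj₂ (slot e′))

    slot-unique : ∀ s {e} → Joins s (tail e) (head e) → s ≡ proj₁ (slot e)
    slot-unique s {e} joins with e′ , refl ← slotted s =
      cong (proj₁ ∘ slot) (joins-functional s (proj₂ (slot e′)) joins)

    G-sym : ∀ {u v} → Adj G u v → Adj G v u
    G-sym (l≢ , a≢) = l≢ ∘ sym , a≢ ∘ sym

    arc-adj : ∀ e → Adj G (tail e) (head e)
    arc-adj (c , a , b) = rot-≢ c , Fin.punchInᵢ≢i a b ∘ sym

    -- Distinctness and adjacency, which `Family` does not state, follow from the counting: a
    -- repeated vertex would contradict `place-unique`, and every step of a walk is the slot of some
    -- arc.
    cycles-of : ∀ φ → Fin (y * 3) → Cycle k G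
    cycles-of φ j = record
      { walk     = λ i → cycle φ j (toℕ i)
      ; distinct = λ {i} {i′} eq → cong proj₂ (trans (place-unique φ {i = i} eq) (sym (place-unique φ {i = i′} refl)))
      ; closed   = λ i → step-adj i (slotted (φ , j , i))
      }
      where
      step-adj : ∀ i → (∃ λ e → proj₁ (slot e) ≡ (φ , j , i)) → Adj G (cycle φ j (toℕ i)) (cycle φ j (toℕ (next i)))
      step-adj i (e , eq) with slot e
      step-adj i (e , refl) | _ , inj₁ (p , q) = subst₂ (Adj G) (sym p) (sym q) (arc-adj e)
      step-adj i (e , refl) | _ , inj₂ (p , q) = subst₂ (Adj G) (sym p) (sym q) (G-sym (arc-adj e))

    factor : Fin n → CkFactor k G
    factor φ = record
      { size   = y * 3
      ; cycles = cycles-of φ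
      ; covers = λ v → let (j , i) , eq = place φ v in
          j , (i , eq) , λ { j′ (i′ , eq′) → cong proj₁ (place-unique φ {i = i′} eq′) }
      }

    Partitioned : V G → V G → Set
    Partitioned u v = ∃! {Σ (Fin n) λ _ → Fin (y * 3)} λ { (φ , j) → CycleEdge (cycles-of φ j) u v }

    partition-arc : ∀ e → Partitioned (tail e) (head e)
    partition-arc e = let (φ , j , i) , joins = slot e in
      (φ , j) , (i , joins) , λ { (φ′ , j′) (i′ , joins′) →
        cong (λ (φ , j , _) → φ , j) (slot-unique (φ′ , j′ , i′) joins′) }

    partition-sym : ∀ {u v} → Partitioned u v → Partitioned v u
    partition-sym (x , (i , joins) , unique) =
      x , (i , swap joins) , λ { x′ (i′ , joins′) → unique x′ (i′ , swap joins′) }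

    partition-up : ∀ u v → proj₁ v ≡ rot (proj₁ u) → proj₂ u ≢ proj₂ v → Partitioned u v
    partition-up (c , a) (_ , b) refl a≢b = subst (λ b → Partitioned (c , a) (rot c , b))
      (Fin.punchIn-punchOut a≢b) (partition-arc (c , a , punchOut a≢b))

    partition-edge : ∀ u v → Adj G u v → Partitioned u v
    partition-edge u v (l≢ , a≢) with rot-total (proj₁ u) (proj₁ v) l≢
    ... | inj₁ up   = partition-up u v up a≢
    ... | inj₂ down = partition-sym (partition-up v u down (a≢ ∘ sym))

  factorization : CkFactorization k (K 3 ⊗ K (suc n))
  factorization = record { count = n ; factors = factor ; partition = partition-edge }

-- Residues modulo n, and interleaved or concatenated sequences

⟦_⟧ : ∀ {n} → ℤ → Fin (suc n)
⟦_⟧ {n} x = fromℕ< (n%ℕd<d x (suc n))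

⟦⟧-residue : ∀ {n} x → ∃ λ q → x ≡ + toℕ (⟦_⟧ {n} x) + q ℤ.* + suc n
⟦⟧-residue {n} x = x /ℕ suc n , trans (a≡a%ℕn+[a/ℕn]*n x (suc n))
  (cong (λ r → + r + (x /ℕ suc n) ℤ.* + suc n) (sym (Fin.toℕ-fromℕ< (n%ℕd<d x (suc n)))))

residue-unique : ∀ {n} (a b : Fin (suc n)) q → + toℕ a ≡ + toℕ b + q ℤ.* + suc n → a ≡ b
residue-unique {n} a b q eq = Fin.toℕ-injective (go q eq)
  where
  open ≡-Reasoning
  shift : ∀ {a b : Fin (suc n)} m → toℕ a ≡ toℕ b ℕ.+ m * suc n → toℕ a ≡ toℕ b
  shift {a} {b} m eq = begin
    toℕ a                                 ≡⟨ m<n⇒m%n≡m (Fin.toℕ<n a) ⟨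
    toℕ a ℕ.% suc n                       ≡⟨ cong (ℕ._% suc n) eq ⟩
    (toℕ b ℕ.+ m * suc n) ℕ.% suc n     ≡⟨ [m+kn]%n≡m%n (toℕ b) m (suc n) ⟩
    toℕ b ℕ.% suc n                       ≡⟨ m<n⇒m%n≡m (Fin.toℕ<n b) ⟩
    toℕ b                                 ∎

  move : ∀ {a b m n} → a ≡ b + (- m) ℤ.* n → b ≡ a + m ℤ.* n
  move {b = b} {m} {n} refl = lemma b m n
    where
    lemma : ∀ b m n → b ≡ b + (- m) ℤ.* n + m ℤ.* n
    lemma = solve-∀

  go : ∀ q → + toℕ a ≡ + toℕ b + q ℤ.* + suc n → toℕ a ≡ toℕ b
  go (+ m)    eq = shift {a} {b} m
    (ℤ.+-injective (trans eq (cong (λ t → + toℕ b + t) (sym (ℤ.pos-* m (suc n))))))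
  -- A negative quotient moves to the other side, which exchanges `a` and `b` and returns to natural
  -- numbers.
  go -[1+ m ] eq = sym (shift {b} {a} (suc m)
    (ℤ.+-injective (trans (move {m = + suc m} {+ suc n} eq) (cong (λ t → + toℕ a + t) (sym (ℤ.pos-* (suc m) (suc n)))))))

⟦⟧-cong : ∀ {n} x y q → x ≡ y + q ℤ.* + suc n → ⟦_⟧ {n} x ≡ ⟦ y ⟧
⟦⟧-cong {n} x y q eq
  with p , x≡ ← ⟦⟧-residue {n} x with r , y≡ ← ⟦⟧-residue {n} y =
  residue-unique ⟦ x ⟧ ⟦ y ⟧ (r + q - p) (begin
    X                                        ≡⟨ cancel X (p ℤ.* N) ⟩
    (X + p ℤ.* N) - p ℤ.* N                  ≡⟨ cong (_- p ℤ.* N) x≡ ⟨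
    x - p ℤ.* N                              ≡⟨ cong (_- p ℤ.* N) eq ⟩
    (y + q ℤ.* N) - p ℤ.* N                  ≡⟨ cong (λ y → (y + q ℤ.* N) - p ℤ.* N) y≡ ⟩
    ((Y + r ℤ.* N) + q ℤ.* N) - p ℤ.* N      ≡⟨ collect Y r q p N ⟩
    Y + (r + q - p) ℤ.* N                    ∎)
  where
  open ≡-Reasoning
  N = + suc n
  X = + toℕ (⟦_⟧ {n} x)
  Y = + toℕ (⟦_⟧ {n} y)
  cancel : ∀ a b → a ≡ (a + b) - b
  cancel = solve-∀
  collect : ∀ Y r q p N → ((Y + r ℤ.* N) + q ℤ.* N) - p ℤ.* N ≡ Y + (r + q - p) ℤ.* N
  collect = solve-∀

⟦⟧-toℕ : ∀ {n} (a : Fin (suc n)) → ⟦ + toℕ a ⟧ ≡ a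
⟦⟧-toℕ {n} a with q , eq ← ⟦⟧-residue {n} (+ toℕ a) = sym (residue-unique a ⟦ + toℕ a ⟧ q eq)

-- This makes the tours below depend on their integer start only modulo n + 1.
⟦⟧-absorb : ∀ {n} x z → ⟦_⟧ {n} (+ toℕ (⟦_⟧ {n} x) + z) ≡ ⟦ x + z ⟧
⟦⟧-absorb {n} x z with q , eq ← ⟦⟧-residue {n} x =
  sym (⟦⟧-cong (x + z) (+ toℕ (⟦_⟧ {n} x) + z) q (trans (cong (_+ z) eq) (reorder (+ toℕ (⟦_⟧ {n} x)) (q ℤ.* + suc n) z)))
  where
  reorder : ∀ a b c → a + b + c ≡ a + c + b
  reorder = solve-∀

⟦⟧-diff : ∀ {n} x (a : Fin (suc n)) → ⟦ x + + toℕ (⟦_⟧ {n} (+ toℕ a - x)) ⟧ ≡ a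
⟦⟧-diff {n} x a = begin
  ⟦ x + + toℕ δ ⟧         ≡⟨ cong ⟦_⟧ (ℤ.+-comm x (+ toℕ δ)) ⟩
  ⟦ + toℕ δ + x ⟧         ≡⟨ ⟦⟧-absorb (+ toℕ a - x) x ⟩
  ⟦ + toℕ a - x + x ⟧     ≡⟨ cong ⟦_⟧ (cancel (+ toℕ a) x) ⟩
  ⟦ + toℕ a ⟧             ≡⟨ ⟦⟧-toℕ a ⟩
  a                       ∎
  where
  open ≡-Reasoning
  δ = ⟦_⟧ {n} (+ toℕ a - x)
  cancel : ∀ a x → a - x + x ≡ a
  cancel = solve-∀

data Parity : ℕ → Set where
  even : ∀ r → Parity (r ℕ.+ r)
  odd  : ∀ r → Parity (suc (r ℕ.+ r))

parity : ∀ n → Parity n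
parity zero = even zero
parity (suc n) with parity n
... | even r = odd r
... | odd r  = subst Parity (cong suc (ℕ.+-suc r r)) (even (suc r))

interleave : ∀ {X : Set} → (ℕ → X) → (ℕ → X) → ℕ → X
interleave f g zero    = f zero
interleave f g (suc i) = interleave g (f ∘ suc) i

interleave-even : ∀ {X : Set} (f g : ℕ → X) r → interleave f g (r ℕ.+ r) ≡ f r
interleave-even f g zero = refl
interleave-even f g (suc r) rewrite ℕ.+-suc r r = interleave-even (f ∘ suc) (g ∘ suc) r

interleave-odd : ∀ {X : Set} (f g : ℕ → X) r → interleave f g (suc (r ℕ.+ r)) ≡ g r
interleave-odd f g r = interleave-even g (f ∘ suc) r

interleave-cong : ∀ {X : Set} {f f′ g g′ : ℕ → X} → (∀ r → f r ≡ f′ r) → (∀ r → g r ≡ g′ r) →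
  ∀ i → interleave f g i ≡ interleave f′ g′ i
interleave-cong f≗ g≗ zero    = f≗ zero
interleave-cong f≗ g≗ (suc i) = interleave-cong g≗ (f≗ ∘ suc) i

splice : ∀ {X : Set} → ℕ → (ℕ → X) → (ℕ → X) → ℕ → X
splice zero    f g i       = g i
splice (suc n) f g zero    = f zero
splice (suc n) f g (suc i) = splice n (f ∘ suc) g i

splice-< : ∀ {X : Set} n (f g : ℕ → X) {i} → i < n → splice n f g i ≡ f i
splice-< (suc n) f g {zero}  _         = refl
splice-< (suc n) f g {suc i} (s≤s i<n) = splice-< n (f ∘ suc) g i<n

splice-+ : ∀ {X : Set} n (f g : ℕ → X) i → splice n f g (n ℕ.+ i) ≡ g i
splice-+ zero    f g i = refl
splice-+ (suc n) f g i = splice-+ n (f ∘ suc) g i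

splice-cong : ∀ {X : Set} n {f f′ g g′ : ℕ → X} → (∀ i → f i ≡ f′ i) → (∀ i → g i ≡ g′ i) →
  ∀ i → splice n f g i ≡ splice n f′ g′ i
splice-cong zero    f≗ g≗ i       = g≗ i
splice-cong (suc n) f≗ g≗ zero    = f≗ zero
splice-cong (suc n) f≗ g≗ (suc i) = splice-cong n (f≗ ∘ suc) g≗ i

-- Going up from `a` to `b` takes e + 1 steps and going on round to `a` takes d + 1; together they
-- make 2z + 1, so one of them is at most z.
near-< : ∀ {z} (a b : Fin (suc (z ℕ.+ z))) → toℕ a < toℕ b → ∃ λ d → d < z ×
  (b ≡ ⟦ + toℕ a + + suc d ⟧ ⊎ a ≡ ⟦ + toℕ b + + suc d ⟧)
near-< {z} a b a<b with e , a+e≡b ← ℕ.m≤n⇒∃[o]m+o≡n a<b with e ℕ.<? z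
... | yes e<z = e , e<z , inj₁ (begin
  b                        ≡⟨ ⟦⟧-toℕ b ⟨
  ⟦ + toℕ b ⟧              ≡⟨ cong (λ t → ⟦ + t ⟧) (trans (ℕ.+-suc (toℕ a) e) a+e≡b) ⟨
  ⟦ + toℕ a + + suc e ⟧    ∎)
  where open ≡-Reasoning
... | no e≮z with d , e+d≡2z ← ℕ.m≤n⇒∃[o]m+o≡n {suc e} {z ℕ.+ z}
                   (ℕ.≤-trans (s≤s (ℕ.m≤n+m e (toℕ a)))
                     (subst (_≤ z ℕ.+ z) (sym a+e≡b) (ℕ.s≤s⁻¹ (Fin.toℕ<n b))))
  = d , ℕ.+-cancelˡ-≤ e (suc d) z (subst (_≤ e ℕ.+ z) (sym e+1+d) (ℕ.+-monoˡ-≤ z (ℕ.≮⇒≥ e≮z)))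
  , inj₂ (sym (trans (⟦⟧-cong _ (+ toℕ a) (+ 1) wrap) (⟦⟧-toℕ a)))
  where
  open ≡-Reasoning
  e+1+d : e ℕ.+ suc d ≡ z ℕ.+ z
  e+1+d = trans (ℕ.+-suc e d) e+d≡2z
  wrap : + toℕ b + + suc d ≡ + toℕ a + + 1 ℤ.* + suc (z ℕ.+ z)
  wrap = begin
    + (toℕ b ℕ.+ suc d)                ≡⟨ cong (λ t → + (t ℕ.+ suc d)) a+e≡b ⟨
    + (suc (toℕ a ℕ.+ e) ℕ.+ suc d)    ≡⟨ cong (λ t → + suc t) (ℕ.+-assoc (toℕ a) e (suc d)) ⟩
    + suc (toℕ a ℕ.+ (e ℕ.+ suc d))    ≡⟨ cong (λ t → + suc (toℕ a ℕ.+ t)) e+1+d ⟩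
    + suc (toℕ a ℕ.+ (z ℕ.+ z))        ≡⟨ cong +_ (ℕ.+-suc (toℕ a) (z ℕ.+ z)) ⟨
    + toℕ a + + suc (z ℕ.+ z)          ≡⟨ cong (λ t → + toℕ a + t) (ℤ.*-identityˡ (+ suc (z ℕ.+ z))) ⟨
    + toℕ a + + 1 ℤ.* + suc (z ℕ.+ z)    ∎

-- In a cyclic group of odd order 2z+1, one of b - a and a - b has a representative in [1, z].
near : ∀ {z} (a b : Fin (suc (z ℕ.+ z))) → a ≢ b → ∃ λ d → d < z ×
  (b ≡ ⟦ + toℕ a + + suc d ⟧ ⊎ a ≡ ⟦ + toℕ b + + suc d ⟧)
near a b a≢b with ℕ.<-cmp (toℕ a) (toℕ b)
... | tri< a<b _ _ = near-< a b a<b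
... | tri≈ _ eq _  = contradiction (Fin.toℕ-injective eq) a≢b
... | tri> _ _ b<a = Σ.map₂ (Σ.map₂ swap) (near-< b a b<a)

-- Proper walks in K_3

neg : Fin 3 → Fin 3
neg zero             = zero
neg (suc zero)       = suc (suc zero)
neg (suc (suc zero)) = suc zero

-- Negation reverses direction: a climb from `u` to `rot u` becomes a descent.
neg-rot : ∀ u → neg u ≡ rot (neg (rot u))
neg-rot = from-yes (Fin.all? λ u → neg u Fin.≟ rot (neg (rot u)))

-- The levels sum to 0 in Z_3, so for distinct `u` and `v` this is the remaining one.
third : Fin 3 → Fin 3 → Fin 3
third u v = neg (u ⊕ v)

third-≢ˡ : ∀ u v → u ≢ v → u ≢ third u v
third-≢ˡ = from-yes (Fin.all? λ u → Fin.all? λ v → ¬? (u Fin.≟ v) →-dec ¬? (u Fin.≟ third u v))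

third-≢ʳ : ∀ u v → u ≢ v → third u v ≢ v
third-≢ʳ = from-yes (Fin.all? λ u → Fin.all? λ v → ¬? (u Fin.≟ v) →-dec ¬? (third u v Fin.≟ v))

-- u, t, u, t, ... with t the third level, reaching v after n + 1 steps.
path : Fin 3 → Fin 3 → ℕ → ℕ → Fin 3
path u v n       zero    = u
path u v zero    (suc j) = v
path u v (suc n) (suc j) = path (third u v) v n j

path-end : ∀ u v n → path u v n (suc n) ≡ v
path-end u v zero    = refl
path-end u v (suc n) = path-end (third u v) v n

-- The current level always differs from `v`, so the closing step is allowed whenever it comes.
path-proper : ∀ u v n → u ≢ v → ∀ {j} → j ≤ n → path u v n j ≢ path u v n (suc j)
path-proper u v zero    u≢v z≤n       = u≢v
path-proper u v (suc n) u≢v z≤n       = third-≢ˡ u v u≢v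
path-proper u v (suc n) u≢v (s≤s j≤n) = path-proper (third u v) v n (third-≢ʳ u v u≢v) j≤n

module _ {Φ W : Set} {k : ℕ} {walks : Φ → ℕ → Levelled W} {p q : W} {u v : Fin 3} (u≢v : u ≢ v) where

  -- The same change of level with the points exchanged: one link climbs from `p` to `q`, the other
  -- from `q` to `p`.
  joined-alike : ∀ φ ψ → Link k (walks φ) (u , p) (v , q) → Link k (walks ψ) (u , q) (v , p) →
    Joined k walks p q × Joined k walks q p
  joined-alike φ ψ pq qp with rot-total u v u≢v
  ... | inj₁ refl = (_ , u , pq) , (_ , u , qp)
  ... | inj₂ refl = (_ , v , swap qp) , (_ , v , swap pq)

  -- Negated levels climb the other way, so again the two links serve both orientations of the pair.
  joined-opposite : ∀ φ ψ → Link k (walks φ) (u , p) (v , q) → Link k (walks ψ) (neg u , p) (neg v , q) →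
    Joined k walks p q × Joined k walks q p
  joined-opposite φ ψ pq pq⁻ with rot-total u v u≢v
  ... | inj₁ refl = (_ , u , pq) ,
    (_ , neg v , swap (subst (λ t → Link k _ (t , p) (neg v , q)) (neg-rot u) pq⁻))
  ... | inj₂ refl = (_ , neg u , subst (λ t → Link k _ (neg u , p) (t , q)) (neg-rot v) pq⁻) ,
    (_ , v , swap pq)

-- An arc may be exhibited on the tour from any integer start; periodicity then finds it in the
-- factor of the residue. Each factor is a single Hamiltonian cycle up to rotation, whence `⊤`.
periodic-family : ∀ {k n W _∼_} (tour : ℤ → ℕ → Levelled W) →
  (∀ x i → tour x i ≡ tour (+ toℕ (⟦_⟧ {n} x)) i) →
  (∀ x a → ∃ λ i → i < k × proj₂ (tour x i) ≡ a) →
  (∀ {a b} → a ∼ b → Joined k tour a b) →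
  Family k (Fin (suc n)) ⊤ W _∼_
periodic-family {k} {n} tour periodic visits joined = record
  { walks = λ φ _ → tour (+ toℕ φ)
  ; onto  = λ φ a → let i , i<k , eq = visits (+ toℕ φ) a in
      tt , fromℕ< i<k , trans (cong (proj₂ ∘ tour (+ toℕ φ)) (Fin.toℕ-fromℕ< i<k)) eq
  ; arcs  = λ a∼b → let x , c , link = joined a∼b in
      (⟦ x ⟧ , tt) , c , ⊎.map (step-cong (periodic x)) (step-cong (periodic x)) link
  }

-- K_3 × K_{2h}

module Complete (f : ℕ) where
  -- `h` is half of the cycle length, at least 3, and g + g + 1 = 2h - 1 is the modulus.
  g h : ℕ
  g = suc (suc f)
  h = suc g

  -- The graceful path A on 0, ..., g.
  zig : ℕ → ℕ
  zig = interleave id (g ∸_)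

  -- The lower half of the values stands at even positions, the upper half at odd ones.
  zig-onto : ∀ {v} → v ≤ g → ∃ λ j → j ≤ g × zig j ≡ v
  zig-onto {v} v≤g with v ℕ.+ v ℕ.≤? g
  ... | yes 2v≤g = v ℕ.+ v , 2v≤g , interleave-even id (g ∸_) v
  ... | no 2v≰g = suc (r ℕ.+ r) , 2r<g , trans (interleave-odd id (g ∸_) r) (ℕ.m∸[m∸n]≡n v≤g)
    where
    r = g ∸ v
    r+v≡g : r ℕ.+ v ≡ g
    r+v≡g = ℕ.m∸n+n≡m v≤g
    r<v : r < v
    r<v = ℕ.+-cancelʳ-< v r v (subst (_< v ℕ.+ v) (sym r+v≡g) (ℕ.≰⇒> 2v≰g))
    2r<g : r ℕ.+ r < g
    2r<g = subst (r ℕ.+ r <_) r+v≡g (ℕ.+-monoʳ-< r r<v)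

  -- The step at position j has length g - j, upwards for even j and downwards for odd j.
  zig-step : ∀ {d} → d < g → ∃ λ j → j < g × (zig (suc j) ≡ zig j ℕ.+ suc d ⊎ zig j ≡ zig (suc j) ℕ.+ suc d)
  zig-step {d} d<g with j , eq ← ℕ.m≤n⇒∃[o]m+o≡n d<g = j , subst (j <_) eq (s≤s (ℕ.m≤n+m j d)) , go (parity j) eq
    where
    go : ∀ {j} → Parity j → suc d ℕ.+ j ≡ g → zig (suc j) ≡ zig j ℕ.+ suc d ⊎ zig j ≡ zig (suc j) ℕ.+ suc d
    go (even r) eq = inj₁ (begin
      zig (suc (r ℕ.+ r))       ≡⟨ interleave-odd id (g ∸_) r ⟩
      g ∸ r                     ≡⟨ cong (_∸ r) eq ⟨
      suc d ℕ.+ (r ℕ.+ r) ∸ r   ≡⟨ cong (_∸ r) (trans (sym (ℕ.+-assoc (suc d) r r)) (cong (ℕ._+ r) (ℕ.+-comm (suc d) r))) ⟩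
      r ℕ.+ suc d ℕ.+ r ∸ r     ≡⟨ ℕ.m+n∸n≡m (r ℕ.+ suc d) r ⟩
      r ℕ.+ suc d               ≡⟨ cong (ℕ._+ suc d) (interleave-even id (g ∸_) r) ⟨
      zig (r ℕ.+ r) ℕ.+ suc d   ∎)
      where open ≡-Reasoning
    go (odd r) eq = inj₂ (begin
      zig (suc (r ℕ.+ r))                 ≡⟨ interleave-odd id (g ∸_) r ⟩
      g ∸ r                               ≡⟨ cong (_∸ r) eq ⟨
      suc d ℕ.+ (suc r ℕ.+ r) ∸ r         ≡⟨ cong (_∸ r) (trans (sym (ℕ.+-assoc (suc d) (suc r) r)) (cong (ℕ._+ r) (ℕ.+-comm (suc d) (suc r)))) ⟩
      suc r ℕ.+ suc d ℕ.+ r ∸ r           ≡⟨ ℕ.m+n∸n≡m (suc r ℕ.+ suc d) r ⟩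
      suc r ℕ.+ suc d                     ≡⟨ cong (ℕ._+ suc d) (interleave-even id (g ∸_) (suc r)) ⟨
      zig (suc r ℕ.+ suc r) ℕ.+ suc d     ≡⟨ cong (λ i → zig (suc i) ℕ.+ suc d) (ℕ.+-suc r r) ⟩
      zig (suc (suc (r ℕ.+ r))) ℕ.+ suc d ∎)
      where open ≡-Reasoning

  -- The argument `suc f` gives g steps. The end 2 makes the middle step of the tour descend, from 2
  -- to its negative 1, along the difference g, which the first step climbs from 0 to 1.
  level : ℕ → Fin 3
  level = path zero (suc (suc zero)) (suc f)

  level-proper : ∀ {j} → j < g → level j ≢ level (suc j)
  level-proper (s≤s j≤) = path-proper _ _ (suc f) (λ ()) j≤

  level-end : level g ≡ suc (suc zero)
  level-end = path-end zero (suc (suc zero)) (suc f)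

  -- The point at infinity is zero.
  Point : Set
  Point = Fin (suc (suc (g ℕ.+ g)))

  pt : ℤ → Point
  pt x = suc ⟦ x ⟧

  -- `bwd` is indexed by positions on A and is run from `g` down to 0. At index 0 infinity replaces
  -- A_0 + g, which equals A_1 and lies on the first half already.
  fwd bwd tour : ℤ → ℕ → Levelled Point
  fwd x j       = level j , pt (x + + zig j)
  bwd x zero    = suc zero , zero
  bwd x (suc j) = neg (level (suc j)) , pt (x + + (g ℕ.+ zig (suc j)))
  tour x = splice h (fwd x) (λ i → bwd x (g ∸ i))

  tour-fwd : ∀ x {j} → j ≤ g → tour x j ≡ fwd x j
  tour-fwd x j≤g = splice-< h (fwd x) _ (s≤s j≤g)

  tour-bwd : ∀ x {j} → j ≤ g → tour x (h ℕ.+ (g ∸ j)) ≡ bwd x j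
  tour-bwd x {j} j≤g = trans (splice-+ h (fwd x) _ (g ∸ j)) (cong (bwd x) (ℕ.m∸[m∸n]≡n j≤g))

  bwd-bound : ∀ {j} → h ℕ.+ (g ∸ j) < h ℕ.+ h
  bwd-bound {j} = ℕ.+-monoʳ-< h (s≤s (ℕ.m∸n≤m g j))

  step-fwd : ∀ x {j} → j < g → Step (h ℕ.+ h) (tour x) (fwd x j) (fwd x (suc j))
  step-fwd x {j} j<g = subst₂ (Step _ _) (tour-fwd x (ℕ.<⇒≤ j<g)) (tour-fwd x j<g)
    (step-inner (tour x) (ℕ.≤-trans (s≤s j<g) (ℕ.m≤m+n h h)))

  step-mid : ∀ x → Step (h ℕ.+ h) (tour x) (fwd x g) (bwd x g)
  step-mid x = subst₂ (Step _ _) (tour-fwd x ℕ.≤-refl)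
    (trans (cong (tour x) (sym (ℕ.+-identityʳ h))) (splice-+ h (fwd x) _ 0))
    (step-inner (tour x) (ℕ.m<m+n h (s≤s z≤n)))

  step-bwd : ∀ x {j} → j < g → Step (h ℕ.+ h) (tour x) (bwd x (suc j)) (bwd x j)
  step-bwd x {j} j<g = subst₂ (Step _ _) (tour-bwd x j<g) (trans (cong (tour x) next≡) (tour-bwd x (ℕ.<⇒≤ j<g)))
    (step-inner (tour x) (subst (_< h ℕ.+ h) (sym next≡) (bwd-bound {j})))
    where
    next≡ : suc (h ℕ.+ (g ∸ suc j)) ≡ h ℕ.+ (g ∸ j)
    next≡ = trans (sym (ℕ.+-suc h (g ∸ suc j))) (cong (h ℕ.+_) (sym (ℕ.+-∸-assoc 1 j<g)))

  step-close : ∀ x → Step (h ℕ.+ h) (tour x) (bwd x 0) (fwd x 0)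
  step-close x = subst₂ (Step _ _) (tour-bwd x z≤n) refl
    (step-last (tour x) (sym (ℕ.+-suc h g)))

  Both : Point → Point → Set
  Both a b = Joined (h ℕ.+ h) tour a b × Joined (h ℕ.+ h) tour b a

  -- For positive j the second occurrence is the mirrored step on the return, with negated levels,
  -- of the tour started g earlier. For j = 0 it is the middle step.
  joined-step : ∀ x {j} → j < g → Both (pt (x + + zig j)) (pt (x + + zig (suc j)))
  joined-step x {zero}  0<g = (x , zero , inj₁ (step-fwd x 0<g)) , (x - + zig g , suc zero , inj₂ mid)
    where
    shift₁ : ∀ x z → x - z + z ≡ x + + 0
    shift₁ = solve-∀
    shift₂ : ∀ x z g → x - z + (g + z) ≡ x + g
    shift₂ = solve-∀
    mid : Step (h ℕ.+ h) (tour (x - + zig g)) (suc (suc zero) , pt (x + + 0)) (suc zero , pt (x + + g))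
    mid = subst₂ (Step _ _)
      (cong₂ _,_ level-end (cong pt (shift₁ x (+ zig g))))
      (cong₂ _,_ (cong neg level-end) (cong pt (shift₂ x (+ zig g) (+ g))))
      (step-mid (x - + zig g))
  joined-step x {suc j} j<g = joined-opposite {walks = tour} (level-proper j<g) x (x - + g) (inj₁ (step-fwd x j<g)) (inj₂ back)
    where
    shift : ∀ x g z → x - g + (g + z) ≡ x + z
    shift = solve-∀
    back : Step (h ℕ.+ h) (tour (x - + g))
      (neg (level (suc (suc j))) , pt (x + + zig (suc (suc j)))) (neg (level (suc j)) , pt (x + + zig (suc j)))
    back = subst₂ (Step _ _) (cong (λ z → _ , pt z) (shift x (+ g) (+ zig (suc (suc j)))))
      (cong (λ z → _ , pt z) (shift x (+ g) (+ zig (suc j)))) (step-bwd (x - + g) j<g)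

  joined-distance : ∀ x {d} → d < g → Both (pt x) (pt (x + + suc d))
  joined-distance x {d} d<g = go (zig-step d<g)
    where
    shift₁ : ∀ x z → x - z + z ≡ x
    shift₁ = solve-∀
    shift₂ : ∀ x z s → x - z + (z + s) ≡ x + s
    shift₂ = solve-∀
    near-end : ∀ j → pt (x - + zig j + + zig j) ≡ pt x
    near-end j = cong pt (shift₁ x (+ zig j))
    far-end : ∀ i j → zig j ≡ zig i ℕ.+ suc d → pt (x - + zig i + + zig j) ≡ pt (x + + suc d)
    far-end i j eq = cong pt (trans (cong (λ z → x - + zig i + + z) eq) (shift₂ x (+ zig i) (+ suc d)))
    go : (∃ λ j → j < g × (zig (suc j) ≡ zig j ℕ.+ suc d ⊎ zig j ≡ zig (suc j) ℕ.+ suc d)) →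
      Both (pt x) (pt (x + + suc d))
    go (j , j<g , inj₁ up)   = subst₂ Both (near-end j) (far-end j (suc j) up) (joined-step (x - + zig j) j<g)
    go (j , j<g , inj₂ down) = Σ.swap (subst₂ Both (far-end (suc j) j down) (near-end (suc j)) (joined-step (x - + zig (suc j)) j<g))

  -- Infinity has level 1, between a neighbour at level 2 and one at level 0: it climbs to the
  -- former and is reached by a climb from the latter. Shifting the tour makes either neighbour an
  -- arbitrary point.
  joined-∞ : ∀ a → Joined (h ℕ.+ h) tour zero (pt a)
  joined-∞ a = x , suc zero , inj₂ (subst (λ z → Step _ (tour x) (suc (suc zero) , pt z) (suc zero , zero))
    (shift a (+ (g ℕ.+ zig 1))) (step-bwd x (s≤s z≤n)))
    where
    x = a - + (g ℕ.+ zig 1)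
    shift : ∀ x z → x - z + z ≡ x
    shift = solve-∀

  ∞-joined : ∀ a → Joined (h ℕ.+ h) tour (pt a) zero
  ∞-joined a = a , zero , inj₂ (subst (λ z → Step _ (tour a) (suc zero , zero) (zero , pt z))
    (ℤ.+-identityʳ a) (step-close a))

  joined : ∀ {a b} → a ≢ b → Joined (h ℕ.+ h) tour a b
  joined {zero}  {zero}  a≢b = contradiction refl a≢b
  joined {zero}  {suc b} _   = subst (Joined _ tour zero ∘ suc) (⟦⟧-toℕ b) (joined-∞ (+ toℕ b))
  joined {suc a} {zero}  _   = subst (λ a → Joined _ tour (suc a) zero) (⟦⟧-toℕ a) (∞-joined (+ toℕ a))
  joined {suc a} {suc b} a≢b with near {g} a b (a≢b ∘ cong suc)
  ... | d , d<g , inj₁ refl = subst (λ t → Joined _ tour (suc t) (pt (+ toℕ a + + suc d))) (⟦⟧-toℕ a)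
    (proj₁ (joined-distance (+ toℕ a) d<g))
  ... | d , d<g , inj₂ refl = subst (λ t → Joined _ tour (pt (+ toℕ b + + suc d)) (suc t)) (⟦⟧-toℕ b)
    (proj₂ (joined-distance (+ toℕ b) d<g))

  -- Offsets 0, ..., g from `x` lie on the first half, g + 1, ..., 2g on the second.
  tour-visits : ∀ x a → ∃ λ i → i < h ℕ.+ h × proj₂ (tour x i) ≡ a
  tour-visits x zero    = h ℕ.+ g , ℕ.+-monoʳ-< h (ℕ.n<1+n g) , cong proj₂ (tour-bwd x z≤n)
  tour-visits x (suc a) with toℕ δ ℕ.≤? g
    where
    δ = ⟦ + toℕ a - x ⟧
  ... | yes δ≤g with j , j≤g , eq ← zig-onto δ≤g =
    j , ℕ.≤-trans (s≤s j≤g) (ℕ.m≤m+n h h)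
      , trans (cong proj₂ (tour-fwd x j≤g)) (cong suc (trans (cong (λ z → ⟦ x + + z ⟧) eq) (⟦⟧-diff x a)))
  ... | no δ≰g with v , g+v≡δ ← ℕ.m≤n⇒∃[o]m+o≡n (ℕ.≰⇒> δ≰g)
               with zig-onto {suc v} (ℕ.+-cancelˡ-≤ g (suc v) g
                      (subst (_≤ g ℕ.+ g) (trans (sym g+v≡δ) (sym (ℕ.+-suc g v))) (ℕ.s≤s⁻¹ (Fin.toℕ<n ⟦ + toℕ a - x ⟧))))
  -- Position 0 is excluded because A_0 = 0, whereas the value sought is positive.
  ...   | suc j , j<g , eq =
    h ℕ.+ (g ∸ suc j) , bwd-bound {suc j}
      , trans (cong proj₂ (tour-bwd x j<g))
          (cong suc (trans (cong (λ z → ⟦ x + + z ⟧) (trans (cong (g ℕ.+_) eq) (trans (ℕ.+-suc g v) g+v≡δ))) (⟦⟧-diff x a)))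

  tour-periodic : ∀ x i → tour x i ≡ tour (+ toℕ (⟦_⟧ {g ℕ.+ g} x)) i
  tour-periodic x = splice-cong h
    (λ j → cong (λ p → level j , suc p) (sym (⟦⟧-absorb x (+ zig j))))
    (λ i → bwd-periodic (g ∸ i))
    where
    bwd-periodic : ∀ j → bwd x j ≡ bwd (+ toℕ (⟦_⟧ {g ℕ.+ g} x)) j
    bwd-periodic zero    = refl
    bwd-periodic (suc j) = cong (λ p → neg (level (suc j)) , suc p) (sym (⟦⟧-absorb x (+ (g ℕ.+ zig (suc j)))))

  family : Family (h ℕ.+ h) (Fin (suc (g ℕ.+ g))) ⊤ Point _≢_
  family = periodic-family tour tour-periodic tour-visits joined

-- K_3 × K_{h,h}

OppositeSides : ∀ {X : Set} → Fin 2 × X → Fin 2 × X → Set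
OppositeSides (s , _) (t , _) = s ≢ t

module Bipartite (f : ℕ) where
  h : ℕ
  h = suc (suc (suc f))

  Point : Set
  Point = Fin 2 × Fin h

  left right : ℤ → Point
  left x  = zero , ⟦ x ⟧
  right x = suc zero , ⟦ x ⟧

  -- The step at position j joins a left and a right point whose difference, left minus right, is j;
  -- over 2h steps each residue modulo h occurs twice.
  pt : ℤ → ℕ → Point
  pt x = interleave (λ r → left (x + + r)) (λ r → right (x - + r))

  pt-even : ∀ x r {i} → i ≡ r ℕ.+ r → pt x i ≡ left (x + + r)
  pt-even x r refl = interleave-even _ _ r

  pt-odd : ∀ x r {i} → i ≡ suc (r ℕ.+ r) → pt x i ≡ right (x - + r)
  pt-odd x r refl = interleave-odd (λ r → left (x + + r)) (λ r → right (x - + r)) r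

  pt-closed : ∀ x → pt x (h ℕ.+ h) ≡ pt x 0
  pt-closed x = trans (pt-even x h refl)
    (cong (zero ,_) (⟦⟧-cong (x + + h) (x + + 0) (+ 1) (lemma x (+ h))))
    where
    lemma : ∀ x h → x + h ≡ x + + 0 + + 1 ℤ.* h
    lemma = solve-∀

  -- Positions j and h + j carry the same difference: the edge at position j of one
  -- cycle is the edge at position h + j of another, reversed if h is odd.
  turn-even : ∀ {e} → h ≡ e ℕ.+ e → ∀ x i → pt (x - + e) (h ℕ.+ i) ≡ pt x i
  turn-even {e} h≡ x i with parity i
  ... | even r = begin
    pt (x - + e) (h ℕ.+ (r ℕ.+ r))    ≡⟨ pt-even (x - + e) (e ℕ.+ r) (trans (cong (ℕ._+ (r ℕ.+ r)) h≡) (regroup e r)) ⟩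
    left (x - + e + (+ e + + r))      ≡⟨ cong left (shift x (+ e) (+ r)) ⟩
    left (x + + r)                    ≡⟨ pt-even x r refl ⟨
    pt x (r ℕ.+ r)                    ∎
    where
    open ≡-Reasoning
    regroup : ∀ e r → e ℕ.+ e ℕ.+ (r ℕ.+ r) ≡ e ℕ.+ r ℕ.+ (e ℕ.+ r)
    regroup = ℕ-solve-∀
    shift : ∀ x e r → x - e + (e + r) ≡ x + r
    shift = solve-∀
  ... | odd r = begin
    pt (x - + e) (h ℕ.+ suc (r ℕ.+ r))    ≡⟨ pt-odd (x - + e) (e ℕ.+ r) (trans (cong (ℕ._+ suc (r ℕ.+ r)) h≡) (regroup e r)) ⟩
    right (x - + e - (+ e + + r))         ≡⟨ cong (suc zero ,_) (⟦⟧-cong _ (x - + r) (- + 1) wrap) ⟩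
    right (x - + r)                       ≡⟨ pt-odd x r refl ⟨
    pt x (suc (r ℕ.+ r))                  ∎
    where
    open ≡-Reasoning
    regroup : ∀ e r → e ℕ.+ e ℕ.+ suc (r ℕ.+ r) ≡ suc (e ℕ.+ r ℕ.+ (e ℕ.+ r))
    regroup = ℕ-solve-∀
    shift : ∀ x e r → x - e - (e + r) ≡ x - r + - + 1 ℤ.* (e + e)
    shift = solve-∀
    wrap : x - + e - (+ e + + r) ≡ x - + r + - + 1 ℤ.* + h
    wrap = trans (shift x (+ e) (+ r)) (cong (λ t → x - + r + - + 1 ℤ.* + t) (sym h≡))

  turn-odd : ∀ {e} → h ≡ suc (e ℕ.+ e) → ∀ x j →
    ∃ λ x′ → pt x′ (h ℕ.+ j) ≡ pt x (suc j) × pt x′ (h ℕ.+ suc j) ≡ pt x j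
  turn-odd {e} h≡ x j with parity j
  -- Position h + 2r is odd here, with right point x′ - (e + r); equating it with x - r gives the
  -- start. For odd j the left points are compared instead, which gives x - e.
  ... | even r = x + + e , (begin
    pt (x + + e) (h ℕ.+ (r ℕ.+ r))        ≡⟨ pt-odd (x + + e) (e ℕ.+ r) (trans (cong (ℕ._+ (r ℕ.+ r)) h≡) (regroup₁ e r)) ⟩
    right (x + + e - (+ e + + r))         ≡⟨ cong right (shift₁ x (+ e) (+ r)) ⟩
    right (x - + r)                       ≡⟨ pt-odd x r refl ⟨
    pt x (suc (r ℕ.+ r))                  ∎) , (begin
    pt (x + + e) (h ℕ.+ suc (r ℕ.+ r))    ≡⟨ pt-even (x + + e) (suc (e ℕ.+ r)) (trans (cong (ℕ._+ suc (r ℕ.+ r)) h≡) (regroup₂ e r)) ⟩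
    left (x + + e + (+ 1 + (+ e + + r)))  ≡⟨ cong (zero ,_) (⟦⟧-cong _ (x + + r) (+ 1) wrap) ⟩
    left (x + + r)                        ≡⟨ pt-even x r refl ⟨
    pt x (r ℕ.+ r)                        ∎)
    where
    open ≡-Reasoning
    regroup₁ : ∀ e r → suc (e ℕ.+ e) ℕ.+ (r ℕ.+ r) ≡ suc (e ℕ.+ r ℕ.+ (e ℕ.+ r))
    regroup₁ = ℕ-solve-∀
    regroup₂ : ∀ e r → suc (e ℕ.+ e) ℕ.+ suc (r ℕ.+ r) ≡ suc (e ℕ.+ r) ℕ.+ suc (e ℕ.+ r)
    regroup₂ = ℕ-solve-∀
    shift₁ : ∀ x e r → x + e - (e + r) ≡ x - r
    shift₁ = solve-∀
    shift₂ : ∀ x e r → x + e + (+ 1 + (e + r)) ≡ x + r + + 1 ℤ.* (+ 1 + (e + e))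
    shift₂ = solve-∀
    wrap : x + + e + (+ 1 + (+ e + + r)) ≡ x + + r + + 1 ℤ.* + h
    wrap = trans (shift₂ x (+ e) (+ r)) (cong (λ t → x + + r + + 1 ℤ.* + t) (sym h≡))
  ... | odd r = x - + e , (begin
    pt (x - + e) (h ℕ.+ suc (r ℕ.+ r))          ≡⟨ pt-even (x - + e) (suc (e ℕ.+ r)) (trans (cong (ℕ._+ suc (r ℕ.+ r)) h≡) (regroup₁ e r)) ⟩
    left (x - + e + (+ 1 + (+ e + + r)))        ≡⟨ cong left (shift₁ x (+ e) (+ r)) ⟩
    left (x + + suc r)                          ≡⟨ pt-even x (suc r) (cong suc (sym (ℕ.+-suc r r))) ⟨
    pt x (suc (suc (r ℕ.+ r)))                  ∎) , (begin
    pt (x - + e) (h ℕ.+ suc (suc (r ℕ.+ r)))    ≡⟨ pt-odd (x - + e) (suc (e ℕ.+ r)) (trans (cong (ℕ._+ suc (suc (r ℕ.+ r))) h≡) (regroup₂ e r)) ⟩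
    right (x - + e - (+ 1 + (+ e + + r)))       ≡⟨ cong (suc zero ,_) (⟦⟧-cong _ (x - + r) (- + 1) wrap) ⟩
    right (x - + r)                             ≡⟨ pt-odd x r refl ⟨
    pt x (suc (r ℕ.+ r))                        ∎)
    where
    open ≡-Reasoning
    regroup₁ : ∀ e r → suc (e ℕ.+ e) ℕ.+ suc (r ℕ.+ r) ≡ suc (e ℕ.+ r) ℕ.+ suc (e ℕ.+ r)
    regroup₁ = ℕ-solve-∀
    regroup₂ : ∀ e r → suc (e ℕ.+ e) ℕ.+ suc (suc (r ℕ.+ r)) ≡ suc (suc (e ℕ.+ r) ℕ.+ suc (e ℕ.+ r))
    regroup₂ = ℕ-solve-∀
    shift₁ : ∀ x e r → x - e + (+ 1 + (e + r)) ≡ x + (+ 1 + r)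
    shift₁ = solve-∀
    shift₂ : ∀ x e r → x - e - (+ 1 + (e + r)) ≡ x - r + - + 1 ℤ.* (+ 1 + (e + e))
    shift₂ = solve-∀
    wrap : x - + e - (+ 1 + (+ e + + r)) ≡ x - + r + - + 1 ℤ.* + h
    wrap = trans (shift₂ x (+ e) (+ r)) (cong (λ t → x - + r + - + 1 ℤ.* + t) (sym h≡))

  -- A proper closed walk of length h on the levels. It is based at 0, which negation fixes, so a
  -- second round can follow with or without negation.
  loop : ℕ → Fin 3
  loop zero    = zero
  loop (suc j) = path (suc zero) zero (suc f) j

  loop-end : loop h ≡ zero
  loop-end = path-end (suc zero) zero (suc f)

  loop-proper : ∀ {j} → j < h → loop j ≢ loop (suc j)
  loop-proper {zero}  _               = λ ()
  loop-proper {suc j} (s≤s (s≤s j≤f)) = path-proper (suc zero) zero (suc f) (λ ()) j≤f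

  -- For even h the second occurrence of an edge has its ends in the same order, so the levels must
  -- be negated; for odd h the ends are exchanged and the levels repeat.
  turn : ∀ {n} → Parity n → Fin 3 → Fin 3
  turn (even _) = neg
  turn (odd _)  = id

  turn-zero : ∀ {n} (p : Parity n) → turn p zero ≡ zero
  turn-zero (even _) = refl
  turn-zero (odd _)  = refl

  level : ℕ → Fin 3
  level = splice h loop (turn (parity h) ∘ loop)

  level-< : ∀ {j} → j ≤ h → level j ≡ loop j
  level-< {j} j≤h with ℕ.m≤n⇒m<n∨m≡n j≤h
  ... | inj₁ j<h  = splice-< h loop _ j<h
  ... | inj₂ refl = begin
    level h                       ≡⟨ cong level (ℕ.+-identityʳ h) ⟨
    level (h ℕ.+ 0)               ≡⟨ splice-+ h loop _ 0 ⟩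
    turn (parity h) (loop 0)      ≡⟨ turn-zero (parity h) ⟩
    zero                          ≡⟨ loop-end ⟨
    loop h                        ∎
    where open ≡-Reasoning

  level-+ : ∀ j → level (h ℕ.+ j) ≡ turn (parity h) (loop j)
  level-+ = splice-+ h loop _

  tour : ℤ → ℕ → Levelled Point
  tour x i = level i , pt x i

  tour-closed : ∀ x → tour x (h ℕ.+ h) ≡ tour x 0
  tour-closed x = cong₂ _,_
    (trans (level-+ h) (trans (cong (turn (parity h)) loop-end) (turn-zero (parity h)))) (pt-closed x)

  tour-step : ∀ x {i} → i < h ℕ.+ h → Step (h ℕ.+ h) (tour x) (tour x i) (tour x (suc i))
  tour-step x {i} i<k with ℕ.m≤n⇒m<n∨m≡n i<k
  ... | inj₁ 1+i<k = step-inner (tour x) 1+i<k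
  ... | inj₂ 1+i≡k = subst (Step (h ℕ.+ h) (tour x) (tour x i))
    (sym (trans (cong (tour x) 1+i≡k) (tour-closed x))) (step-last (tour x) 1+i≡k)

  Both : Point → Point → Set
  Both a b = Joined (h ℕ.+ h) tour a b × Joined (h ℕ.+ h) tour b a

  step-first : ∀ x {j} → j < h → Step (h ℕ.+ h) (tour x) (loop j , pt x j) (loop (suc j) , pt x (suc j))
  step-first x {j} j<h = subst₂ (Step _ _) (cong (_, pt x j) (level-< (ℕ.<⇒≤ j<h))) (cong (_, pt x (suc j)) (level-< j<h))
    (tour-step x (ℕ.≤-trans j<h (ℕ.m≤m+n h h)))

  step-second : ∀ x {j p q σ} → j < h → turn (parity h) ≡ σ →
    pt x (h ℕ.+ j) ≡ p → pt x (h ℕ.+ suc j) ≡ q →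
    Step (h ℕ.+ h) (tour x) (σ (loop j) , p) (σ (loop (suc j)) , q)
  step-second x {j} j<h refl refl refl = subst₂ (Step _ _)
    (cong (_, pt x (h ℕ.+ j)) (level-+ j)) (trans (cong (tour x) (sym (ℕ.+-suc h j))) (cong (_, pt x (h ℕ.+ suc j)) (level-+ (suc j))))
    (tour-step x (ℕ.+-monoʳ-< h j<h))

  -- Parity by equations, since the fixed expression `h` does not unify with e + e.
  data ParityOf (n : ℕ) : Parity n → Set where
    is-even : ∀ e {p} → n ≡ e ℕ.+ e → turn p ≡ neg → ParityOf n p
    is-odd  : ∀ e {p} → n ≡ suc (e ℕ.+ e) → turn p ≡ id → ParityOf n p

  parityOf : ∀ {n} (p : Parity n) → ParityOf n p
  parityOf (even e) = is-even e refl refl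
  parityOf (odd e)  = is-odd e refl refl

  joined-step : ∀ x {j} → j < h → Both (pt x j) (pt x (suc j))
  joined-step x {j} j<h with parityOf (parity h)
  ... | is-even e h≡ turn≡ = joined-opposite {walks = tour} (loop-proper j<h) x (x - + e) (inj₁ (step-first x j<h))
    (inj₁ (step-second (x - + e) j<h turn≡ (turn-even {e} h≡ x j) (turn-even {e} h≡ x (suc j))))
  ... | is-odd e h≡ turn≡ with x′ , p , q ← turn-odd {e} h≡ x j =
    joined-alike {walks = tour} (loop-proper j<h) x x′ (inj₁ (step-first x j<h)) (inj₁ (step-second x′ j<h turn≡ p q))

  -- The difference of `a` and `b` is the position j of the step; with r the half of j rounded down,
  -- the start b + r puts `b` at its right end.
  joined-sides : ∀ a b → Both (zero , a) (suc zero , b)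
  joined-sides a b = go (parity j) (Fin.toℕ<n ⟦ + toℕ a - + toℕ b ⟧) (⟦⟧-diff (+ toℕ b) a)
    where
    j = toℕ (⟦_⟧ {suc (suc f)} (+ toℕ a - + toℕ b))
    b′ = + toℕ b
    go : ∀ {j} → Parity j → j < h → ⟦ b′ + + j ⟧ ≡ a → Both (zero , a) (suc zero , b)
    go (even r) j<h eq = subst₂ Both
      (trans (pt-even (b′ + + r) r refl) (cong (zero ,_) (trans (cong ⟦_⟧ (ℤ.+-assoc b′ (+ r) (+ r))) eq)))
      (trans (pt-odd (b′ + + r) r refl) (cong (suc zero ,_) (trans (cong ⟦_⟧ (cancel b′ (+ r))) (⟦⟧-toℕ b))))
      (joined-step (b′ + + r) j<h)
      where
      cancel : ∀ b r → b + r - r ≡ b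
      cancel = solve-∀
    go (odd r) j<h eq = Σ.swap (subst₂ Both
      (trans (pt-odd (b′ + + r) r refl) (cong (suc zero ,_) (trans (cong ⟦_⟧ (cancel b′ (+ r))) (⟦⟧-toℕ b))))
      (trans (pt-even (b′ + + r) (suc r) (cong suc (sym (ℕ.+-suc r r))))
        (cong (zero ,_) (trans (cong ⟦_⟧ (regroup b′ (+ r))) eq)))
      (joined-step (b′ + + r) j<h))
      where
      cancel : ∀ b r → b + r - r ≡ b
      cancel = solve-∀
      regroup : ∀ b r → b + r + (+ 1 + r) ≡ b + (+ 1 + (r + r))
      regroup = solve-∀

  joined : ∀ {a b} → OppositeSides a b → Joined (h ℕ.+ h) tour a b
  joined {zero , _}     {zero , _}     s≢t = contradiction refl s≢t
  joined {zero , a}     {suc zero , b} _   = proj₁ (joined-sides a b)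
  joined {suc zero , a} {zero , b}     _   = proj₂ (joined-sides b a)
  joined {suc zero , _} {suc zero , _} s≢t = contradiction refl s≢t

  tour-visits : ∀ x a → ∃ λ i → i < h ℕ.+ h × proj₂ (tour x i) ≡ a
  tour-visits x (zero , a) = r ℕ.+ r , ℕ.+-mono-< r<h r<h ,
    trans (pt-even x r refl) (cong (zero ,_) (⟦⟧-diff x a))
    where
    r = toℕ (⟦_⟧ {suc (suc f)} (+ toℕ a - x))
    r<h = Fin.toℕ<n (⟦_⟧ {suc (suc f)} (+ toℕ a - x))
  tour-visits x (suc zero , b) with q , eq ← ⟦⟧-residue {suc (suc f)} (x - + toℕ b) =
    suc (r ℕ.+ r) , ℕ.≤-trans (ℕ.≤-reflexive (cong suc (sym (ℕ.+-suc r r)))) (ℕ.+-mono-≤ r<h r<h) ,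
    trans (pt-odd x r refl) (cong (suc zero ,_) (trans (⟦⟧-cong (x - + r) (+ toℕ b) q x-r) (⟦⟧-toℕ b)))
    where
    r = toℕ (⟦_⟧ {suc (suc f)} (x - + toℕ b))
    r<h = Fin.toℕ<n (⟦_⟧ {suc (suc f)} (x - + toℕ b))
    split : ∀ x b r → x - r ≡ b + ((x - b) - r)
    split = solve-∀
    cancel : ∀ r s → r + s - r ≡ s
    cancel = solve-∀
    x-r : x - + r ≡ + toℕ b + q ℤ.* + h
    x-r = trans (split x (+ toℕ b) (+ r))
      (cong (λ t → + toℕ b + t) (trans (cong (_- + r) eq) (cancel (+ r) (q ℤ.* + h))))

  tour-periodic : ∀ x i → tour x i ≡ tour (+ toℕ (⟦_⟧ {suc (suc f)} x)) i
  tour-periodic x i = cong (level i ,_) (interleave-cong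
    (λ r → cong (zero ,_) (sym (⟦⟧-absorb x (+ r)))) (λ r → cong (suc zero ,_) (sym (⟦⟧-absorb x (- + r)))) i)

  family : Family (h ℕ.+ h) (Fin h) ⊤ Point OppositeSides
  family = periodic-family tour tour-periodic tour-visits (λ {a} {b} → joined {a} {b})

-- Blowing up a 1-factorization

-- Only coverage is recorded; the count of slots in the blown-up family turns it into exactness.
record OneFactorization (colours pairs points : ℕ) : Set where
  field
    ends      : Fin colours → Fin pairs → Fin 2 → Fin points
    ends-onto : ∀ c p → ∃₂ λ j s → ends c j s ≡ p
    ends-pair : ∀ {p q} → p ≢ q → ∃₂ λ c j → ∃₂ λ s t → s ≢ t × ends c j s ≡ p × ends c j t ≡ q

module RoundRobin (z : ℕ) where
  m : ℕ
  m = z ℕ.+ z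

  -- The round-robin schedule: colour `c` pairs the point at infinity, `zero`, with `c`, and the
  -- other points by reflection in `c`.
  ends : Fin (suc m) → Fin (suc z) → Fin 2 → Fin (suc (suc m))
  ends c zero    zero       = zero
  ends c zero    (suc zero) = suc c
  ends c (suc r) zero       = suc ⟦ + toℕ c + + suc (toℕ r) ⟧
  ends c (suc r) (suc zero) = suc ⟦ + toℕ c - + suc (toℕ r) ⟧

  ends-onto : ∀ c p → ∃₂ λ j s → ends c j s ≡ p
  ends-onto c zero = zero , zero , refl
  ends-onto c (suc p) with c Fin.≟ p
  ... | yes refl = zero , suc zero , refl
  ... | no c≢p with near {z} c p c≢p
  ...   | d , d<z , inj₁ refl = suc (fromℕ< d<z) , zero ,
    cong (λ d → suc ⟦ + toℕ c + + suc d ⟧) (Fin.toℕ-fromℕ< d<z)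
  ...   | d , d<z , inj₂ refl = suc (fromℕ< d<z) , suc zero , cong suc (begin
    ⟦ + toℕ (⟦_⟧ {m} (p′ + + suc d)) - + suc (toℕ (fromℕ< d<z)) ⟧
      ≡⟨ cong (λ e → ⟦ + toℕ (⟦_⟧ {m} (p′ + + suc d)) - + suc e ⟧) (Fin.toℕ-fromℕ< d<z) ⟩
    ⟦ + toℕ (⟦_⟧ {m} (p′ + + suc d)) - + suc d ⟧    ≡⟨ ⟦⟧-absorb (p′ + + suc d) (- + suc d) ⟩
    ⟦ p′ + + suc d - + suc d ⟧                      ≡⟨ cong ⟦_⟧ (cancel p′ (+ suc d)) ⟩
    ⟦ p′ ⟧                                          ≡⟨ ⟦⟧-toℕ p ⟩
    p                                               ∎)
    where
    open ≡-Reasoning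
    p′ = + toℕ p
    cancel : ∀ p d → p + d - d ≡ p
    cancel = solve-∀

  Matched : Fin (suc (suc m)) → Fin (suc (suc m)) → Set
  Matched p q = ∃₂ λ c j → ∃₂ λ s t → s ≢ t × ends c j s ≡ p × ends c j t ≡ q

  matched-sym : ∀ {p q} → Matched p q → Matched q p
  matched-sym (c , j , s , t , s≢t , p , q) = c , j , t , s , s≢t ∘ sym , q , p

  matched-± : ∀ x {r} → r < z → Matched (suc ⟦ x + + suc r ⟧) (suc ⟦ x - + suc r ⟧)
  matched-± x {r} r<z = ⟦ x ⟧ , suc (fromℕ< r<z) , zero , suc zero , (λ ()) , cong suc (centre (λ r → + r)) , cong suc (centre (λ r → - + r))
    where
    centre : (sign : ℕ → ℤ) → ⟦_⟧ {m} (+ toℕ (⟦_⟧ {m} x) + sign (suc (toℕ (fromℕ< r<z)))) ≡ ⟦ x + sign (suc r) ⟧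
    centre sign = trans (⟦⟧-absorb x _) (cong (λ r → ⟦ x + sign (suc r) ⟧) (Fin.toℕ-fromℕ< r<z))

  -- An even distance 2r is spanned from the midpoint, an odd one around the other half of the circle.
  matched-distance : ∀ x {d} → d < z → Matched (suc ⟦ x + + suc d ⟧) (suc ⟦ x ⟧)
  matched-distance x {d} d<z = go (parity (suc d)) d<z (s≤s z≤n)
    where
    go : ∀ {d} → Parity d → d ≤ z → 0 < d → Matched (suc ⟦ x + + d ⟧) (suc ⟦ x ⟧)
    go (even zero)    _    ()
    go (even (suc r)) 2r≤z _ = subst₂ Matched
      (cong (λ t → suc ⟦ t ⟧) (ℤ.+-assoc x (+ suc r) (+ suc r)))
      (cong (λ t → suc ⟦ t ⟧) (cancel x (+ suc r)))
      (matched-± (x + + suc r) (ℕ.≤-trans (ℕ.m≤m+n (suc r) (suc r)) 2r≤z))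
      where
      cancel : ∀ x r → x + r - r ≡ x
      cancel = solve-∀
    -- The other way round has length 2z + 1 - (2r + 1) = 2(o + 1), so its midpoint lies o + 1
    -- beyond x + 2r + 1.
    go (odd r) 2r<z _ with o , r+o≡z ← ℕ.m≤n⇒∃[o]m+o≡n (ℕ.≤-trans (s≤s (ℕ.m≤m+n r r)) 2r<z) =
      matched-sym (subst₂ Matched
        (cong suc (⟦⟧-cong _ x (+ 1) (wrap r+o≡z)))
        (cong (λ t → suc ⟦ t ⟧) (cancel (x + + suc (r ℕ.+ r)) (+ suc o)))
        (matched-± (x + + suc (r ℕ.+ r) + + suc o)
          (subst (suc o ≤_) r+o≡z (s≤s (ℕ.m≤n+m o r)))))
      where
      cancel : ∀ x r → x + r - r ≡ x
      cancel = solve-∀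
      shift : ∀ x r o → x + (+ 1 + (r + r)) + (+ 1 + o) + (+ 1 + o) ≡ x + + 1 ℤ.* (+ 1 + (+ 1 + (r + o) + (+ 1 + (r + o))))
      shift = solve-∀
      wrap : ∀ {o} → suc r ℕ.+ o ≡ z → x + + suc (r ℕ.+ r) + + suc o + + suc o ≡ x + + 1 ℤ.* + suc m
      wrap {o} refl = shift x (+ r) (+ o)

  ends-pair : ∀ {p q} → p ≢ q → Matched p q
  ends-pair {zero}  {zero}  p≢q = contradiction refl p≢q
  ends-pair {zero}  {suc q} _   = q , zero , zero , suc zero , (λ ()) , refl , refl
  ends-pair {suc p} {zero}  _   = p , zero , suc zero , zero , (λ ()) , refl , refl
  ends-pair {suc p} {suc q} p≢q with near {z} p q (p≢q ∘ cong suc)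
  ... | d , d<z , inj₁ refl = matched-sym
    (subst (λ t → Matched (suc ⟦ + toℕ p + + suc d ⟧) (suc t)) (⟦⟧-toℕ p) (matched-distance (+ toℕ p) d<z))
  ... | d , d<z , inj₂ refl =
    subst (λ t → Matched (suc ⟦ + toℕ q + + suc d ⟧) (suc t)) (⟦⟧-toℕ q) (matched-distance (+ toℕ q) d<z)

  oneFactorization : OneFactorization (suc m) (suc z) (suc (suc m))
  oneFactorization = record { ends = ends ; ends-onto = ends-onto ; ends-pair = ends-pair }

relabel : ∀ {k} {Φ Φ′ J W W′ : Set} → Φ′ ↔ Φ → W ↔ W′ → Family k Φ J W _≢_ → Family k Φ′ J W′ _≢_
relabel {k} Φ↔ W↔ F = record
  { walks = walks′
  ; onto  = λ φ a → let j , i , eq = onto (Inverse.to Φ↔ φ) (from a) in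
      j , i , trans (cong to eq) (strictlyInverseˡ a)
  ; arcs  = λ {a} {b} a≢b →
      subst₂ (Joined k (Σ.uncurry walks′)) (strictlyInverseˡ a) (strictlyInverseˡ b)
        (relabelled (arcs λ eq → a≢b (trans (sym (strictlyInverseˡ a)) (trans (cong to eq) (strictlyInverseˡ b)))))
  }
  where
  open Family F
  open Inverse W↔ using (to; from; strictlyInverseˡ)

  walks′ = λ φ j → Σ.map₂ to ∘ walks (Inverse.to Φ↔ φ) j

  relabelled : ∀ {a b} → Joined k (Σ.uncurry walks) a b → Joined k (Σ.uncurry walks′) (to a) (to b)
  relabelled {a} {b} ((φ , j) , c , link) = (Inverse.from Φ↔ φ , j) , c ,
    subst (λ ψ → Link k (Σ.map₂ to ∘ walks ψ j) (c , to a) (rot c , to b)) (sym (Inverse.strictlyInverseˡ Φ↔ φ))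
      (link-map (Σ.map₂ to) link)

-- The first colour carries copies of the complete graph on two layers, which also
-- takes care of the edges inside a layer; the others only join opposite layers.
blow-up : ∀ {k colours pairs points Φ₁ Φ₂ n} → OneFactorization (suc colours) pairs points →
  Family k Φ₁ ⊤ (Fin 2 × Fin n) _≢_ → Family k Φ₂ ⊤ (Fin 2 × Fin n) OppositeSides →
  Family k (Φ₁ ⊎ Fin colours × Φ₂) (Fin pairs) (Fin points × Fin n) _≢_
blow-up {k} {colours} {pairs} {points} {Φ₁} {Φ₂} {n} O F₁ F₂ = record { walks = walks ; onto = onto ; arcs = arcs }
  where
  open OneFactorization O
  module F₁ = Family F₁
  module F₂ = Family F₂

  Φ = Φ₁ ⊎ Fin colours × Φ₂

  place : Fin (suc colours) → Fin pairs → Fin 2 × Fin n → Fin points × Fin n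
  place c j = Σ.map₁ (ends c j)

  walks : Φ → Fin pairs → ℕ → Levelled (Fin points × Fin n)
  walks (inj₁ φ)       j = Σ.map₂ (place zero j) ∘ F₁.walks φ tt
  walks (inj₂ (c , φ)) j = Σ.map₂ (place (suc c) j) ∘ F₂.walks φ tt

  onto : ∀ φ a → ∃₂ λ j (i : Fin k) → proj₂ (walks φ j (toℕ i)) ≡ a
  onto (inj₁ φ) (p , a) with j , s , refl ← ends-onto zero p with _ , i , eq ← F₁.onto φ (s , a) =
    j , i , cong (place zero j) eq
  onto (inj₂ (c , φ)) (p , a) with j , s , refl ← ends-onto (suc c) p with _ , i , eq ← F₂.onto φ (s , a) =
    j , i , cong (place (suc c) j) eq

  from₁ : ∀ j {a b} → a ≢ b → Joined k (Σ.uncurry walks) (place zero j a) (place zero j b)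
  from₁ j a≢b = let (φ , _) , c , link = F₁.arcs a≢b in
    (inj₁ φ , j) , c , link-map (Σ.map₂ (place zero j)) link

  from₂ : ∀ c j {a b} → OppositeSides a b → Joined k (Σ.uncurry walks) (place (suc c) j a) (place (suc c) j b)
  from₂ c j {a} {b} a∼b = let (φ , _) , l , link = F₂.arcs {a} {b} a∼b in
    (inj₂ (c , φ) , j) , l , link-map (Σ.map₂ (place (suc c) j)) link

  arcs : ∀ {a b} → a ≢ b → Joined k (Σ.uncurry walks) a b
  arcs {p , a} {q , b} a≢b with p Fin.≟ q
  ... | yes refl with j , s , refl ← ends-onto zero p = from₁ j {s , a} {s , b} (a≢b ∘ cong (place zero j))
  ... | no p≢q with ends-pair p≢q
  ...   | zero  , j , s , t , s≢t , refl , refl = from₁ j {s , a} {t , b} (s≢t ∘ cong proj₁)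
  ...   | suc c , j , s , t , s≢t , refl , refl = from₂ c j {s , a} {t , b} s≢t

-- Assembling the factorization of K_3 × K_{ky}

module _ (f z : ℕ) where
  private
    g h n : ℕ
    g = suc (suc f)
    h = suc g
    -- With y = z + 1 there are 2z + 1 colours: the first yields 2h - 1 factors, each of the other
    -- 2z yields h.
    n = suc (g ℕ.+ g) ℕ.+ (z ℕ.+ z) * h

    ≡⇒↔ : ∀ {a b} → a ≡ b → Fin a ↔ Fin b
    ≡⇒↔ refl = ↔-refl

    two-layers : Fin (suc (suc (g ℕ.+ g))) ↔ (Fin 2 × Fin h)
    two-layers = ↔-trans (≡⇒↔ (sizes g)) Fin.*↔×
      where
      sizes : ∀ g → suc (suc (g ℕ.+ g)) ≡ 2 * suc g
      sizes = ℕ-solve-∀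

    factors↔ : Fin n ↔ (Fin (suc (g ℕ.+ g)) ⊎ Fin (z ℕ.+ z) × Fin h)
    factors↔ = ↔-trans Fin.+↔⊎ (↔-refl ⊎-↔ Fin.*↔×)

    points↔ : (Fin (suc (suc (z ℕ.+ z))) × Fin h) ↔ Fin (suc n)
    points↔ = ↔-trans (↔-sym Fin.*↔×) (≡⇒↔ (sizes g z))
      where
      sizes : ∀ g z → suc (suc (z ℕ.+ z)) * suc g ≡ suc (suc (g ℕ.+ g) ℕ.+ (z ℕ.+ z) * suc g)
      sizes = ℕ-solve-∀

    size≡ : suc n ≡ (h ℕ.+ h) * suc z
    size≡ = sizes g z
      where
      sizes : ∀ g z → suc (suc (g ℕ.+ g) ℕ.+ (z ℕ.+ z) * suc g) ≡ (suc g ℕ.+ suc g) * suc z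
      sizes = ℕ-solve-∀

    whole : Family (h ℕ.+ h) (Fin n) (Fin (suc z)) (Fin (suc n)) _≢_
    whole = relabel factors↔ points↔
      (blow-up (RoundRobin.oneFactorization z)
        (relabel ↔-refl two-layers (Complete.family f)) (Bipartite.family f))

  factorization-2h : CkFactorization (h ℕ.+ h) (K 3 ⊗ K ((h ℕ.+ h) * suc z))
  factorization-2h = subst (λ m → CkFactorization (h ℕ.+ h) (K 3 ⊗ K m)) size≡ (factorization whole size≡)

theorem3p4 : ∀ (k y : ℕ) → 6 ≤ k → 2 ∣ k → 1 ≤ y → ¬ (2 ∣ y) →
    CkFactorization k (K 3 ⊗ K (k * y))
theorem3p4 k (suc z) 6≤k (divides q k≡q*2) _ _ = go q k≡q*2 6≤k
  where
  double : ∀ h → h ℕ.+ h ≡ h * 2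
  double = ℕ-solve-∀
  go : ∀ q {k} → k ≡ q * 2 → 6 ≤ k → CkFactorization k (K 3 ⊗ K (k * suc z))
  go (suc (suc (suc f))) refl _ = subst (λ k → CkFactorization k (K 3 ⊗ K (k * suc z)))
    (double (suc (suc (suc f)))) (factorization-2h f z)
  go 0 refl ()
  go 1 refl (s≤s (s≤s ()))
  go 2 refl (s≤s (s≤s (s≤s (s≤s ()))))
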